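{- Let $\alpha\in\mathbb{N}$, let $n\in\mathbb{N}$ with $3\nmid n$ and $n>6\alpha+3$, and let $\mathbb{S}=\langle 6,6\alpha+3,n\rangle$, with Betti elements $\beta_1=\beta_2=12\alpha+6$ and $\beta_3=3n$. Then, with respect to $(6,6\alpha+3,n)$, the factorizations of $\beta_1=\beta_2$ are exactly $(2\alpha+1,0,0)$ and $(0,2,0)$, and the factorizations of $\beta_3$ are exactly $(0,0,3)$ and $\left(\frac{n-k(2\alpha+1)}{2},k,0\right)$ for $k\in\mathbb{N}$ with $k\le\frac{n}{2\alpha+1}$ and $2\mid n-k(2\alpha+1)$.
   Context: $\mathbb{N}=\{0,1,2,\dots\}$. $\langle a_1,\dots,a_e\rangle$ is the set of $\mathbb{N}$-linear combinations of $a_1,\dots,a_e$. A factorization of $a\in\langle a_1,a_2,a_3\rangle$ is a tuple $(\eta_1,\eta_2,\eta_3)\in\mathbb{N}^3$ with $\eta_1a_1+\eta_2a_2+\eta_3a_3=a$. -}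

module Defs where

open import Data.Nat using (ℕ; _*_; _>_)
open import Data.Product using (Σ; ∃; _×_; proj₁)
open import Data.Vec using (Vec; lookup; sum; zipWith)
open import Level using (0ℓ)
open import Relation.Binary.Construct.Closure.ReflexiveTransitive using (Star)
open import Relation.Binary.Core using (Rel)
open import Relation.Binary.PropositionalEquality using (_≡_)
open import Relation.Nullary using (¬_)
open import Relation.Unary using (Pred; _∈_)

private
  variable
    e : ℕ

IsFactorization : Vec ℕ e → ℕ → Vec ℕ e → Set
IsFactorization as b η = sum (zipWith _*_ η as) ≡ b

⟨_⟩ : Vec ℕ e → Pred ℕ 0ℓ
⟨ as ⟩ b = ∃ λ η → IsFactorization as b η

Factorization : Vec ℕ e → ℕ → Set
Factorization {e} as b = Σ (Vec ℕ e) (IsFactorization as b)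

-- The graph of factorizations of b: two factorizations are adjacent when some
-- generator occurs in both, i.e. when their dot product is nonzero.
-- Loops are allowed; they do not affect connectedness.
Adjacent : (as : Vec ℕ e) (b : ℕ) → Rel (Factorization as b) 0ℓ
Adjacent as b η ζ = ∃ λ i → lookup (proj₁ η) i > 0 × lookup (proj₁ ζ) i > 0

Connected : Vec ℕ e → ℕ → Set
Connected as b = (η ζ : Factorization as b) → Star (Adjacent as b) η ζ

-- Betti elements are taken with respect to the listed generators, which need
-- not be minimal (for instance 6, 3, n).
IsBettiElement : Vec ℕ e → ℕ → Set
IsBettiElement as b = b ∈ ⟨ as ⟩ × ¬ Connected as b

{-# OPTIONS --safe #-}
-- Modulo 3 and then modulo 2, a value of 6x + (6α+3)y + nz with y < 2 and z < 3
-- determines (x , y , z).  The moves (0,2,0) → (2α+1,0,0), between factorizations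
-- of β₁, and (0,0,3) → (w₁,w₂,0), between factorizations of β₃, bring every
-- factorization of b into this form.  If b is neither β₁ nor β₃, each move leaves
-- a nonzero vector untouched, so it joins adjacent factorizations and b is
-- connected.  In the factorization graphs of β₁ and β₃ the vertices (0,2,0) and
-- (0,0,3) are isolated.
module Submission where

open import Data.Nat using (ℕ; zero; suc; _+_; _*_; _∸_; _>_; _/_; _≤_; _<_; z≤n; s≤s; _%_; NonZero; >-nonZero)
open import Data.Nat.Properties
open import Data.Nat.DivMod using (m≡m%n+[m/n]*n; m%n<n; m*n/n≡m; m/n*n≡m)
open import Data.Nat.Divisibility
open import Data.Nat.Primality using (Prime; prime?; euclidsLemma)
open import Data.Nat.Tactic.RingSolver using (solve-∀)
open import Data.Integer using (+_)
import Data.Integer as ℤ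
import Data.Integer.Properties as ℤₚ
open import Data.Rational.Unnormalised using (*≤*) renaming (_≤_ to _≤ℚ_; _/_ to _/ℚ_)
open import Data.Rational.Unnormalised.Properties using (drop-*≤*)
open import Data.Fin using (Fin; zero; suc)
open import Data.Product using (_×_; ∃; _,_; proj₁; proj₂)
open import Data.Sum using (_⊎_; inj₁; inj₂; [_,_]′; map₂)
open import Data.Vec using (Vec; _∷_; []; lookup; zipWith)
open import Function.Base using (id)
open import Function.Bundles using (_⇔_; mk⇔; Equivalence)
open import Relation.Binary.Construct.Closure.ReflexiveTransitive using (Star; ε; _◅_; _◅◅_; reverse)
open import Relation.Binary.PropositionalEquality using (_≡_; _≢_; refl; sym; trans; cong; cong₂; subst; subst₂)
open import Relation.Nullary using (¬_; yes; no; contradiction)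
open import Relation.Nullary.Decidable using (from-yes; from-no)
open import Defs

-- Moves and isolated vertices in factorization graphs, for arbitrary generators.

private
  variable
    e : ℕ

infixl 6 _⊕_

_⊕_ : Vec ℕ e → Vec ℕ e → Vec ℕ e
_⊕_ = zipWith _+_

⊕-isFactorization : (as u v : Vec ℕ e) {b c : ℕ} → IsFactorization as b u →
                    IsFactorization as c v → IsFactorization as (b + c) (u ⊕ v)
⊕-isFactorization []       []      []      refl refl = refl
⊕-isFactorization (a ∷ as) (x ∷ u) (y ∷ v) refl refl =
  trans (cong (λ s → (x + y) * a + s) (⊕-isFactorization as u v refl refl)) (interchange x y a _ _)
  where
  interchange : ∀ x y a s t → (x + y) * a + (s + t) ≡ (x * a + s) + (y * a + t)
  interchange = solve-∀

support-nonempty : (as γ : Vec ℕ e) → ¬ IsFactorization as 0 γ → ∃ λ i → lookup γ i > 0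
support-nonempty []       []          γ≢0 = contradiction refl γ≢0
support-nonempty (a ∷ as) (zero  ∷ γ) γ≢0 = let i , γᵢ>0 = support-nonempty as γ γ≢0 in suc i , γᵢ>0
support-nonempty (a ∷ as) (suc x ∷ γ) γ≢0 = zero , s≤s z≤n

lookup-⊕-positive : (u γ : Vec ℕ e) (i : Fin e) → lookup γ i > 0 → lookup (u ⊕ γ) i > 0
lookup-⊕-positive (x ∷ u) (y ∷ γ) zero    y>0  = ≤-trans y>0 (m≤n+m y x)
lookup-⊕-positive (x ∷ u) (y ∷ γ) (suc i) γᵢ>0 = lookup-⊕-positive u γ i γᵢ>0

-- The common part `γ` has value `b - β`, which is nonzero as `b ≢ β`. So some entry of `γ` is
-- positive, and that generator occurs both before and after `u` is exchanged for `v`.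
move : (as u v γ : Vec ℕ e) {β b : ℕ} → IsFactorization as β u → IsFactorization as β v → b ≢ β →
       (f : IsFactorization as b (u ⊕ γ)) →
       ∃ λ (g : IsFactorization as b (v ⊕ γ)) → Adjacent as b (u ⊕ γ , f) (v ⊕ γ , g)
move as u v γ {β} {b} fu fv b≢β f =
  trans (⊕-isFactorization as v γ fv refl) (sym b≡) ,
  i , lookup-⊕-positive u γ i γᵢ>0 , lookup-⊕-positive v γ i γᵢ>0
  where
  b≡ = trans (sym f) (⊕-isFactorization as u γ fu refl)
  support = support-nonempty as γ λ γ≡0 → b≢β (trans b≡ (trans (cong (λ s → β + s) γ≡0) (+-identityʳ β)))
  i = proj₁ support
  γᵢ>0 = proj₂ support

Adjacent-sym : (as : Vec ℕ e) (b : ℕ) {η ζ : Factorization as b} → Adjacent as b η ζ → Adjacent as b ζ η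
Adjacent-sym as b (i , ηᵢ>0 , ζᵢ>0) = i , ζᵢ>0 , ηᵢ>0

-- A vertex carries an equation in `ℕ` besides its vector, and proofs of such equations are unique.
factorization-≡ : (as : Vec ℕ e) (b : ℕ) {η ζ : Factorization as b} → proj₁ η ≡ proj₁ ζ → η ≡ ζ
factorization-≡ as b {η , f} {.η , g} refl = cong (η ,_) (≡-irrelevant f g)

-- A neighbour of `u` shares with it a generator, which can only be `i`, and the only factorization
-- using `i` is `u` itself. Thus a path from `u` never leaves it, and `v` is out of reach.
isolated⇒¬connected : (as : Vec ℕ e) {b : ℕ} (u v : Vec ℕ e) (i : Fin e) →
  IsFactorization as b u → IsFactorization as b v → u ≢ v →
  (∀ j → lookup u j > 0 → j ≡ i) →
  (∀ ζ → IsFactorization as b ζ → lookup ζ i > 0 → ζ ≡ u) →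
  ¬ Connected as b
isolated⇒¬connected as {b} u v i fu fv u≢v only-i unique connected =
  u≢v (sym (stays refl (connected (u , fu) (v , fv))))
  where
  stays : {η ζ : Factorization as b} → proj₁ η ≡ u → Star (Adjacent as b) η ζ → proj₁ ζ ≡ u
  stays η≡u ε = η≡u
  stays refl (_◅_ {j = ζ , g} (j , uⱼ>0 , ζⱼ>0) path) with refl ← only-i j uⱼ>0 =
    stays (unique ζ g ζⱼ>0) path

-- Coefficients determined modulo a prime.

module _ {p c : ℕ} (p-prime : Prime p) (p∤c : p ∤ c) where

  divides-coefficient : ∀ A A′ d → p ∣ A → p ∣ A′ → A ≡ A′ + d * c → p ∣ d
  divides-coefficient A A′ d p∣A p∣A′ eq
    with euclidsLemma d c p-prime (∣m+n∣m⇒∣n (subst (p ∣_) eq p∣A) p∣A′)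
  ... | inj₁ p∣d = p∣d
  ... | inj₂ p∣c = contradiction p∣c p∤c

  -- Write `z′ = z + d`. Cancelling `z * c` leaves `A ≡ A′ + d * c`, so `p` divides `d`; since
  -- `d ≤ z′ < p`, this forces `d = 0`.
  coefficient-unique-≤ : ∀ A A′ {z z′} → p ∣ A → p ∣ A′ → z′ < p → z ≤ z′ →
                         A + z * c ≡ A′ + z′ * c → z ≡ z′
  coefficient-unique-≤ A A′ {z} p∣A p∣A′ z′<p z≤z′ eq with m≤n⇒∃[o]m+o≡n z≤z′
  ... | zero  , refl = sym (+-identityʳ z)
  ... | suc d , refl = contradiction
    (divides-coefficient A A′ (suc d) p∣A p∣A′
      (+-cancelʳ-≡ (z * c) A _ (trans eq (rearrange A′ z (suc d) c))))
    (>⇒∤ (≤-<-trans (m≤n+m (suc d) z) z′<p))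
    where
    rearrange : ∀ A z d c → A + (z + d) * c ≡ A + d * c + z * c
    rearrange = solve-∀

  coefficient-unique : ∀ A A′ {z z′} → p ∣ A → p ∣ A′ → z < p → z′ < p →
                       A + z * c ≡ A′ + z′ * c → z ≡ z′
  coefficient-unique A A′ {z} {z′} p∣A p∣A′ z<p z′<p eq with ≤-total z z′
  ... | inj₁ z≤z′ = coefficient-unique-≤ A A′ p∣A p∣A′ z′<p z≤z′ eq
  ... | inj₂ z′≤z = sym (coefficient-unique-≤ A′ A p∣A′ p∣A z<p z′≤z (sym eq))

even-or-odd : ∀ k → ∃ λ j → k ≡ j * 2 ⊎ k ≡ 1 + j * 2
even-or-odd k with k % 2 | m%n<n k 2 | m≡m%n+[m/n]*n k 2
... | 0           | _                | eq = k / 2 , inj₁ eq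
... | 1           | _                | eq = k / 2 , inj₂ eq
... | suc (suc _) | s≤s (s≤s ())     | _

prime-2 : Prime 2
prime-2 = from-yes (prime? 2)

prime-3 : Prime 3
prime-3 = from-yes (prime? 3)

-- Factorizations of `β₁` and `β₃` over `6`, `g = 6α + 3` and `n`.

module _ (α n : ℕ) (3∤n : 3 ∤ n) (n>g : n > 6 * α + 3) where

  private
    g : ℕ
    g = 6 * α + 3

    gens : Vec ℕ 3
    gens = 6 ∷ g ∷ n ∷ []

    β₁ β₃ : ℕ
    β₁ = 12 * α + 6
    β₃ = 3 * n

    instance
      g-nonZero : NonZero g
      g-nonZero = >-nonZero (<-≤-trans (s≤s z≤n) (m≤n+m 3 (6 * α)))

      n-nonZero : NonZero n
      n-nonZero = >-nonZero (≤-<-trans z≤n n>g)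

    value-assoc : ∀ x y z g n → x * 6 + (y * g + (z * n + 0)) ≡ x * 6 + y * g + z * n
    value-assoc = solve-∀

  β₁≡2*g : β₁ ≡ 2 * g
  β₁≡2*g = lemma α
    where
    lemma : ∀ α → 12 * α + 6 ≡ 2 * (6 * α + 3)
    lemma = solve-∀

  2∤g : 2 ∤ g
  2∤g 2∣g = from-no (2 ∣? 3) (∣m+n∣m⇒∣n 2∣g (∣m⇒∣m*n α (divides-refl 3)))

  3∣g : 3 ∣ g
  3∣g = ∣m∣n⇒∣m+n (∣m⇒∣m*n α (divides-refl 2)) ∣-refl

  3∣6x+gy : ∀ x y → 3 ∣ x * 6 + y * g
  3∣6x+gy x y = ∣m∣n⇒∣m+n (∣n⇒∣m*n x (divides-refl 2)) (∣n⇒∣m*n y 3∣g)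

  3∣coefficient : ∀ {b} x y z → 3 ∣ b → IsFactorization gens b (x ∷ y ∷ z ∷ []) → 3 ∣ z
  3∣coefficient x y z 3∣b f = divides-coefficient prime-3 3∤n _ (x * 6 + y * g) z 3∣b (3∣6x+gy x y)
    (trans (sym f) (value-assoc x y z g n))

  z-term-≤ : ∀ {b} x y z → IsFactorization gens b (x ∷ y ∷ z ∷ []) → z * n ≤ b
  z-term-≤ x y z f = subst (z * n ≤_) (trans (sym (value-assoc x y z g n)) f) (m≤n+m (z * n) _)

  y-term-≤ : ∀ {b} x y z → IsFactorization gens b (x ∷ y ∷ z ∷ []) → y * g ≤ b
  y-term-≤ x y z f = subst (y * g ≤_) f (≤-trans (m≤m+n (y * g) _) (m≤n+m _ (x * 6)))

  β₁-x : IsFactorization gens β₁ ((1 + 2 * α) ∷ 0 ∷ 0 ∷ [])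
  β₁-x = lemma α
    where
    lemma : ∀ α → (1 + 2 * α) * 6 + 0 ≡ 12 * α + 6
    lemma = solve-∀

  β₁-y : IsFactorization gens β₁ (0 ∷ 2 ∷ 0 ∷ [])
  β₁-y = trans (+-identityʳ (2 * g)) (sym β₁≡2*g)

  β₃-z : IsFactorization gens β₃ (0 ∷ 0 ∷ 3 ∷ [])
  β₃-z = +-identityʳ (3 * n)

  -- If `n` is even, `3n` is `n/2` times `6`. If `n` is odd, `3n` and `g` are both odd multiples of
  -- 3, so `3n - g` is a multiple of `6`, nonnegative because `n > g`. Here `n = 1 + g + k` with `g`
  -- odd, so `k` has the parity of `n`.
  β₃-xy : ∃ λ x → ∃ λ y → IsFactorization gens β₃ (x ∷ y ∷ 0 ∷ [])
  β₃-xy with m≤n⇒∃[o]m+o≡n n>g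
  ... | k , refl with even-or-odd k
  ... | j , inj₁ refl = 2 + 3 * α + j , 0 , lemma α j
    where
    lemma : ∀ α j → (2 + 3 * α + j) * 6 + 0 ≡ 3 * (1 + (6 * α + 3) + j * 2)
    lemma = solve-∀
  ... | j , inj₂ refl = 2 + 2 * α + j , 1 , lemma α j
    where
    lemma : ∀ α j → (2 + 2 * α + j) * 6 + (1 * (6 * α + 3) + 0) ≡ 3 * (1 + (6 * α + 3) + (1 + j * 2))
    lemma = solve-∀

  -- `z` is a multiple of 3, and `z * n ≤ 2 * g < 2 * n` leaves only `z = 0`. Then `y` is even,
  -- because `β₁` and `x * 6` are even and `g` is odd, and `y * g ≤ 2 * g` leaves `y = 0` or
  -- `y = 2`; either value determines `x`.
  β₁-factorization : ∀ x y z → IsFactorization gens β₁ (x ∷ y ∷ z ∷ []) →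
                     x ∷ y ∷ z ∷ [] ≡ (1 + 2 * α) ∷ 0 ∷ 0 ∷ [] ⊎ x ∷ y ∷ z ∷ [] ≡ 0 ∷ 2 ∷ 0 ∷ []
  β₁-factorization x y z f = by-z (3∣coefficient x y z 3∣β₁ f) z<2
    where
    open ≤-Reasoning
    3∣β₁ : 3 ∣ β₁
    3∣β₁ = subst (3 ∣_) (sym β₁≡2*g) (∣n⇒∣m*n 2 3∣g)

    z<2 : z < 2
    z<2 = *-cancelʳ-< n z 2 (begin-strict
      z * n  ≤⟨ z-term-≤ x y z f ⟩
      β₁     ≡⟨ β₁≡2*g ⟩
      2 * g  <⟨ *-monoʳ-< 2 n>g ⟩
      2 * n  ∎)

    by-z : 3 ∣ z → z < 2 → _
    by-z (divides (suc _) refl) (s≤s (s≤s ()))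
    by-z (divides 0 refl) _ = by-y 2∣y (*-cancelʳ-≤ y 2 g (subst (y * g ≤_) β₁≡2*g (y-term-≤ x y 0 f)))
      where
      2∣y : 2 ∣ y
      2∣y = divides-coefficient prime-2 2∤g β₁ (x * 6) y
        (subst (2 ∣_) (sym β₁≡2*g) (∣m⇒∣m*n g ∣-refl)) (∣n⇒∣m*n x (divides-refl 3))
        (trans (sym f) (cong (λ s → x * 6 + s) (+-identityʳ (y * g))))

      by-y : 2 ∣ y → y ≤ 2 → _
      by-y (divides 0 refl) _ =
        inj₁ (cong (_∷ 0 ∷ 0 ∷ []) (*-cancelʳ-≡ x (1 + 2 * α) 6
          (+-cancelʳ-≡ 0 (x * 6) _ (trans f (sym β₁-x)))))
      by-y (divides 1 refl) _ =
        inj₂ (cong (_∷ 2 ∷ 0 ∷ []) (*-cancelʳ-≡ x 0 6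
          (+-cancelʳ-≡ (2 * g + 0) (x * 6) 0 (trans f (sym β₁-y)))))
      by-y (divides (suc (suc _)) refl) (s≤s (s≤s ()))

  -- `z` is a multiple of 3 and at most 3. For `z = 3` the term `z * n` exhausts `β₃`; for `z = 0`
  -- the equation is divisible by 3, and the quotient is the stated relation.
  β₃-factorization : ∀ x y z → IsFactorization gens β₃ (x ∷ y ∷ z ∷ []) →
                     x ∷ y ∷ z ∷ [] ≡ 0 ∷ 0 ∷ 3 ∷ [] ⊎ z ≡ 0 × x * 2 + y * (1 + 2 * α) ≡ n
  β₃-factorization x y z f =
    by-z (3∣coefficient x y z (∣m⇒∣m*n n ∣-refl) f) (*-cancelʳ-≤ z 3 n (z-term-≤ x y z f))
    where
    by-z : 3 ∣ z → z ≤ 3 → _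
    by-z (divides 0 refl) _ = inj₂ (refl , *-cancelˡ-≡ _ n 3 (trans (lemma x y α) f))
      where
      lemma : ∀ x y α → 3 * (x * 2 + y * (1 + 2 * α)) ≡ x * 6 + (y * (6 * α + 3) + 0)
      lemma = solve-∀
    by-z (divides 1 refl) _ = inj₁ (cong₂ (λ x y → x ∷ y ∷ 3 ∷ [])
      (m*n≡0⇒m≡0 x 6 (m+n≡0⇒m≡0 (x * 6) rest≡0))
      (m*n≡0⇒m≡0 y g (m+n≡0⇒n≡0 (x * 6) rest≡0)))
      where
      rest≡0 : x * 6 + y * g ≡ 0
      rest≡0 = +-cancelʳ-≡ (3 * n) _ 0 (trans (sym (value-assoc x y 3 g n)) f)
    by-z (divides (suc (suc _)) refl) (s≤s (s≤s (s≤s ())))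

  -- Normal forms, and connectedness away from `β₁` and `β₃`.

  normal-form-unique : ∀ {b} x y z x′ y′ z′ → y < 2 → y′ < 2 → z < 3 → z′ < 3 →
    IsFactorization gens b (x ∷ y ∷ z ∷ []) → IsFactorization gens b (x′ ∷ y′ ∷ z′ ∷ []) →
    x ∷ y ∷ z ∷ [] ≡ x′ ∷ y′ ∷ z′ ∷ []
  normal-form-unique x y z x′ y′ z′ y<2 y′<2 z<3 z′<3 f f′
    with values≡ ← trans (sym (value-assoc x y z g n)) (trans f (trans (sym f′) (value-assoc x′ y′ z′ g n)))
    -- Modulo 3 the generators `6` and `g` vanish and `n` is invertible.
    with refl ← coefficient-unique prime-3 3∤n _ _ (3∣6x+gy x y) (3∣6x+gy x′ y′) z<3 z′<3 values≡
    with 6x+gy≡ ← +-cancelʳ-≡ (z * n) (x * 6 + y * g) _ values≡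
    -- With the `n` terms cancelled, `6` vanishes modulo 2 and `g` is odd.
    with refl ← coefficient-unique prime-2 2∤g _ _ (∣n⇒∣m*n x (divides-refl 3)) (∣n⇒∣m*n x′ (divides-refl 3))
                  y<2 y′<2 6x+gy≡
    with refl ← *-cancelʳ-≡ x x′ 6 (+-cancelʳ-≡ (y * g) (x * 6) _ 6x+gy≡) = refl

  module _ {b : ℕ} (b≢β₁ : b ≢ β₁) (b≢β₃ : b ≢ β₃) where

    HasNormalForm : Factorization gens b → Set
    HasNormalForm η = ∃ λ x → ∃ λ y → ∃ λ z → ∃ λ f →
      y < 2 × z < 3 × Star (Adjacent gens b) η (x ∷ y ∷ z ∷ [] , f)

    prepend : ∀ {η ζ} → Adjacent gens b η ζ → HasNormalForm ζ → HasNormalForm η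
    prepend step (x , y , z , f , y<2 , z<3 , path) = x , y , z , f , y<2 , z<3 , step ◅ path

    normalise-y : ∀ x y z f → z < 3 → HasNormalForm (x ∷ y ∷ z ∷ [] , f)
    normalise-y x 0 z f z<3 = x , 0 , z , f , s≤s z≤n , z<3 , ε
    normalise-y x 1 z f z<3 = x , 1 , z , f , s≤s (s≤s z≤n) , z<3 , ε
    normalise-y x (suc (suc y)) z f z<3 =
      let f′ , step = move gens (0 ∷ 2 ∷ 0 ∷ []) ((1 + 2 * α) ∷ 0 ∷ 0 ∷ []) (x ∷ y ∷ z ∷ []) β₁-y β₁-x b≢β₁ f
      in prepend step (normalise-y (1 + 2 * α + x) y z f′ z<3)

    -- The order matters: exchanging three copies of `n` may raise `y`, while exchanging two copies
    -- of `g` leaves `z` alone. So `z` is lowered first.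
    normalise : ∀ x y z f → HasNormalForm (x ∷ y ∷ z ∷ [] , f)
    normalise x y 0 f = normalise-y x y 0 f (s≤s z≤n)
    normalise x y 1 f = normalise-y x y 1 f (s≤s (s≤s z≤n))
    normalise x y 2 f = normalise-y x y 2 f (s≤s (s≤s (s≤s z≤n)))
    normalise x y (suc (suc (suc z))) f =
      let w₁ , w₂ , fw = β₃-xy
          f′ , step = move gens (0 ∷ 0 ∷ 3 ∷ []) (w₁ ∷ w₂ ∷ 0 ∷ []) (x ∷ y ∷ z ∷ []) β₃-z fw b≢β₃ f
      in prepend step (normalise (w₁ + x) (w₂ + y) z f′)

    connected : Connected gens b
    connected (x ∷ y ∷ z ∷ [] , f) (x′ ∷ y′ ∷ z′ ∷ [] , f′) =
      let u , v , w , h , v<2 , w<3 , path = normalise x y z f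
          u′ , v′ , w′ , h′ , v′<2 , w′<3 , path′ = normalise x′ y′ z′ f′
          same = factorization-≡ gens b {u ∷ v ∷ w ∷ [] , h} {u′ ∷ v′ ∷ w′ ∷ [] , h′}
                   (normal-form-unique u v w u′ v′ w′ v<2 v′<2 w<3 w′<3 h h′)
      in subst (Star (Adjacent gens b) _) same path ◅◅ reverse (λ {η ζ} → Adjacent-sym gens b {η} {ζ}) path′

  -- The Betti elements.

  β₁-betti : IsBettiElement gens β₁
  β₁-betti = (0 ∷ 2 ∷ 0 ∷ [] , β₁-y) ,
    isolated⇒¬connected gens {β₁} (0 ∷ 2 ∷ 0 ∷ []) ((1 + 2 * α) ∷ 0 ∷ 0 ∷ []) (suc zero) β₁-y β₁-x (λ ()) only unique
    where
    only : ∀ j → lookup (0 ∷ 2 ∷ 0 ∷ []) j > 0 → j ≡ suc zero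
    only (suc zero) _ = refl
    only zero ()
    only (suc (suc zero)) ()

    unique : ∀ ζ → IsFactorization gens β₁ ζ → lookup ζ (suc zero) > 0 → ζ ≡ 0 ∷ 2 ∷ 0 ∷ []
    unique (x ∷ y ∷ z ∷ []) f y>0 =
      [ (λ ζ≡ → contradiction (subst (λ ζ → lookup ζ (suc zero) > 0) ζ≡ y>0) λ ()) , id ]′ (β₁-factorization x y z f)

  β₃-betti : IsBettiElement gens β₃
  β₃-betti = (0 ∷ 0 ∷ 3 ∷ [] , β₃-z) ,
    -- An isolated vertex disconnects the graph only if there is a second vertex; `β₃-xy` supplies
    -- one.
    isolated⇒¬connected gens {β₃} (0 ∷ 0 ∷ 3 ∷ []) (w₁ ∷ w₂ ∷ 0 ∷ []) (suc (suc zero)) β₃-z fw (λ ()) only unique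
    where
    w₁ = proj₁ β₃-xy
    w₂ = proj₁ (proj₂ β₃-xy)
    fw = proj₂ (proj₂ β₃-xy)

    only : ∀ j → lookup (0 ∷ 0 ∷ 3 ∷ []) j > 0 → j ≡ suc (suc zero)
    only (suc (suc zero)) _ = refl
    only zero ()
    only (suc zero) ()

    unique : ∀ ζ → IsFactorization gens β₃ ζ → lookup ζ (suc (suc zero)) > 0 → ζ ≡ 0 ∷ 0 ∷ 3 ∷ []
    unique (x ∷ y ∷ z ∷ []) f z>0 =
      [ id , (λ (z≡0 , _) → contradiction z≡0 (>⇒≢ z>0)) ]′ (β₃-factorization x y z f)

  -- `β₁` is listed twice because `β₂` has the same value.
  betti : (b : ℕ) → IsBettiElement gens b ⇔ (b ≡ β₁ ⊎ b ≡ β₁ ⊎ b ≡ β₃)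
  betti b = mk⇔ to from
    where
    to : IsBettiElement gens b → b ≡ β₁ ⊎ b ≡ β₁ ⊎ b ≡ β₃
    to (_ , ¬connected) with b ≟ β₁ | b ≟ β₃
    ... | yes b≡β₁ | _        = inj₁ b≡β₁
    ... | no _     | yes b≡β₃ = inj₂ (inj₂ b≡β₃)
    ... | no b≢β₁  | no b≢β₃  = contradiction (connected b≢β₁ b≢β₃) ¬connected

    from : b ≡ β₁ ⊎ b ≡ β₁ ⊎ b ≡ β₃ → IsBettiElement gens b
    from (inj₁ refl)        = β₁-betti
    from (inj₂ (inj₁ refl)) = β₁-betti
    from (inj₂ (inj₂ refl)) = β₃-betti

  -- Explicit lists of factorizations.

  β₁-factorizations : (η : Vec ℕ 3) → IsFactorization gens β₁ η ⇔
    (η ≡ (1 + 2 * α) ∷ 0 ∷ 0 ∷ [] ⊎ η ≡ 0 ∷ 2 ∷ 0 ∷ [])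
  β₁-factorizations (x ∷ y ∷ z ∷ []) = mk⇔ (β₁-factorization x y z)
    λ { (inj₁ refl) → β₁-x ; (inj₂ refl) → β₁-y }

  -- The bound on `k` is an inequality of fractions, and unnormalised fractions are compared by
  -- cross-multiplication in the integers.
  ≤-quotient⇔*≤ : ∀ k → (+ k /ℚ 1) ≤ℚ (+ n /ℚ (1 + 2 * α)) ⇔ k * (1 + 2 * α) ≤ n
  ≤-quotient⇔*≤ k = mk⇔
    (λ k≤ → ℤₚ.drop‿+≤+ (subst₂ ℤ._≤_ lhs rhs (drop-*≤* k≤)))
    (λ k≤ → *≤* (subst₂ ℤ._≤_ (sym lhs) (sym rhs) (ℤ.+≤+ k≤)))
    where
    lhs : + k ℤ.* + (1 + 2 * α) ≡ + (k * (1 + 2 * α))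
    lhs = sym (ℤₚ.pos-* k (1 + 2 * α))
    rhs : + n ℤ.* + 1 ≡ + n
    rhs = ℤₚ.*-identityʳ (+ n)

  β₃-factorizations : (η : Vec ℕ 3) → IsFactorization gens β₃ η ⇔
    (η ≡ 0 ∷ 0 ∷ 3 ∷ [] ⊎
     (∃ λ (k : ℕ) → (+ k /ℚ 1) ≤ℚ (+ n /ℚ (1 + 2 * α))
                  × 2 ∣ (n ∸ k * (1 + 2 * α))
                  × η ≡ ((n ∸ k * (1 + 2 * α)) / 2) ∷ k ∷ 0 ∷ []))
  β₃-factorizations (x ∷ y ∷ z ∷ []) = mk⇔ (λ f → map₂ to (β₃-factorization x y z f)) from
    where
    to : z ≡ 0 × x * 2 + y * (1 + 2 * α) ≡ n →
         ∃ λ (k : ℕ) → (+ k /ℚ 1) ≤ℚ (+ n /ℚ (1 + 2 * α))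
                     × 2 ∣ (n ∸ k * (1 + 2 * α))
                     × x ∷ y ∷ z ∷ [] ≡ ((n ∸ k * (1 + 2 * α)) / 2) ∷ k ∷ 0 ∷ []
    to (refl , eq) = y ,
      -- The parameter `k` is `y`, and `n` minus its multiple of `1 + 2 * α` is `x * 2`; this gives
      -- the bound, the parity and the first coordinate.
      Equivalence.from (≤-quotient⇔*≤ y) (subst (y * (1 + 2 * α) ≤_) eq (m≤n+m _ (x * 2))) ,
      divides x difference≡ ,
      cong (_∷ y ∷ 0 ∷ []) (sym (trans (cong (_/ 2) difference≡) (m*n/n≡m x 2)))
      where
      difference≡ : n ∸ y * (1 + 2 * α) ≡ x * 2
      difference≡ = trans (cong (_∸ y * (1 + 2 * α)) (sym eq)) (m+n∸n≡m (x * 2) (y * (1 + 2 * α)))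

    from : _ → IsFactorization gens β₃ (x ∷ y ∷ z ∷ [])
    from (inj₁ refl) = β₃-z
    -- The parity condition makes the division by 2 exact, and the bound on `k` makes the truncated
    -- subtraction exact.
    from (inj₂ (k , k≤ , 2∣d , refl)) = trans (lemma (d / 2) k α) (cong (3 *_)
      (trans (cong (_+ k * (1 + 2 * α)) (m/n*n≡m 2∣d)) (m∸n+n≡m (Equivalence.to (≤-quotient⇔*≤ k) k≤))))
      where
      d = n ∸ k * (1 + 2 * α)
      lemma : ∀ q k α → q * 6 + (k * (6 * α + 3) + 0) ≡ 3 * (q * 2 + k * (1 + 2 * α))
      lemma = solve-∀

theorem9 : (α n : ℕ) → 3 ∤ n → n > 6 * α + 3 →
    let gens = 6 ∷ (6 * α + 3) ∷ n ∷ []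
        β₁ = 12 * α + 6
        β₂ = 12 * α + 6
        β₃ = 3 * n
    in
      ((b : ℕ) → IsBettiElement gens b ⇔ (b ≡ β₁ ⊎ b ≡ β₂ ⊎ b ≡ β₃))
    × ((η : Vec ℕ 3) → IsFactorization gens β₁ η ⇔
        (η ≡ (1 + 2 * α) ∷ 0 ∷ 0 ∷ [] ⊎ η ≡ 0 ∷ 2 ∷ 0 ∷ []))
    × ((η : Vec ℕ 3) → IsFactorization gens β₃ η ⇔
        (η ≡ 0 ∷ 0 ∷ 3 ∷ [] ⊎
         (∃ λ (k : ℕ) → (+ k /ℚ 1) ≤ℚ (+ n /ℚ (1 + 2 * α))
                      × 2 ∣ (n ∸ k * (1 + 2 * α))
                      × η ≡ ((n ∸ k * (1 + 2 * α)) / 2) ∷ k ∷ 0 ∷ [])))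
theorem9 α n 3∤n n>g = betti α n 3∤n n>g , β₁-factorizations α n 3∤n n>g , β₃-factorizations α n 3∤n n>g
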